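{- Let $G_2$ be the graph with vertex set $\{u_1,\dots,u_5,v_1,\dots,v_{10}\}$ whose edges are the five edges of the cycle $u_1u_2u_3u_4u_5u_1$, the ten edges of the cycle $v_1v_2v_3v_4v_5v_6v_7v_8v_9v_{10}v_1$, and the six edges $u_1v_1$, $u_2v_3$, $u_3v_5$, $u_4v_7$, $u_5v_9$, $v_4v_8$. Then $G_2$ is subcubic, planar, and has girth $5$, and $G_2$ has no $(1,2^4)$-packing edge-coloring.
   Context: A graph is subcubic if its maximum degree is at most $3$. The girth of a graph is the length of a shortest cycle. For distinct edges $e,f$ of $G$, the distance between $e$ and $f$ is the distance between the corresponding vertices of the line graph $L(G)$ (so edges sharing an endpoint are at distance $1$). A $(1,2^4)$-packing edge-coloring of $G$ is a partition of $E(G)$ into five classes (possibly empty) such that in the first class any two distinct edges are at distance at least $2$ (the class is a matching), and in each of the remaining four classes any two distinct edges are at distance at least $3$ (the class is an induced matching). -}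

module Defs where

open import Level using (0ℓ)
open import Data.Nat.Base as ℕ using (ℕ; suc)
open import Data.Fin using (Fin; _<_; #_)
open import Data.Fin.Properties using (any?) renaming (_≟_ to _≟F_)
open import Data.Unit.Base using (⊤)
open import Data.List.Base as List using (List; []; _∷_; _∷ʳ_; allFin; filter)
open import Data.List.Extrema.Nat using (max)
open import Data.List.Membership.Propositional using (_∈_)
import Data.List.Membership.DecPropositional as DecMembership
open import Data.List.Relation.Unary.All as All using (All; all?)
open import Data.List.Relation.Unary.Linked using (Linked)
open import Data.List.Relation.Unary.Unique.Propositional using (Unique)
open import Data.Product.Base using (Σ-syntax; ∃-syntax; _×_; _,_; uncurry)
open import Data.Product.Properties using (≡-dec)
open import Data.Rational as ℚ using (ℚ; 0ℚ; 1ℚ)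
open import Data.Sum.Base as Sum using (_⊎_; inj₁; inj₂)
open import Data.Vec.Base using (Vec; lookup)
open import Function.Base using (_∘_)
open import Relation.Binary.Core using (Rel)
open import Relation.Binary.Definitions using (Decidable; DecidableEquality; Symmetric)
open import Relation.Binary.PropositionalEquality
  using (_≡_; _≢_; refl; sym; cong)
open import Relation.Nullary using (¬_; yes; no; ¬?; _×-dec_; _⊎-dec_)
open import Relation.Nullary.Decidable using (from-yes)

record SimpleGraph (V : Set) : Set₁ where
  infix 4 _~_ _~?_
  field
    _~_      : Rel V 0ℓ
    _~?_     : Decidable _~_
    ~-sym    : Symmetric _~_
    ~-irrefl : ∀ {x} → ¬ (x ~ x)

module _ {n} (G : SimpleGraph (Fin n)) where
  open SimpleGraph G

  degree : Fin n → ℕ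
  degree x = List.length (filter (x ~?_) (allFin n))

  maxDegree : ℕ
  maxDegree = max 0 (List.map degree (allFin n))

  Subcubic : Set
  Subcubic = maxDegree ℕ.≤ 3

module _ {V : Set} (G : SimpleGraph V) where
  open SimpleGraph G

  record Cycle : Set where
    field
      start    : V
      rest     : List V
      distinct : Unique (start ∷ rest)
      closed   : Linked _~_ ((start ∷ rest) ∷ʳ start)
    length : ℕ
    length = suc (List.length rest)
    field
      3≤length : 3 ℕ.≤ length

  HasGirth : ℕ → Set
  HasGirth g = (Σ[ C ∈ Cycle ] Cycle.length C ≡ g) × (∀ C → g ℕ.≤ Cycle.length C)

  data Walk : V → V → ℕ → Set where
    []  : ∀ {x} → Walk x x 0
    _∷_ : ∀ {x y z l} → x ~ y → Walk y z l → Walk x z (suc l)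

  -- The distance is the least length of a walk, and infinite if there is none.
  DistanceAtLeast : ℕ → V → V → Set
  DistanceAtLeast d x y = ∀ {l} → Walk x y l → d ℕ.≤ l

-- An edge {x , y} is represented once, with its smaller end first.  The proofs
-- are irrelevant, so edges with the same ends are equal.
record Edge {n} (G : SimpleGraph (Fin n)) : Set where
  constructor edge
  open SimpleGraph G
  field
    end₁ end₂ : Fin n
    .ordered  : end₁ < end₂
    .adjacent : end₁ ~ end₂

module _ {n} {G : SimpleGraph (Fin n)} where
  open Edge

  IsEnd : Fin n → Edge G → Set
  IsEnd x e = x ≡ end₁ e ⊎ x ≡ end₂ e

  ShareEnd : Rel (Edge G) 0ℓ
  ShareEnd e f = ∃[ x ] IsEnd x e × IsEnd x f

  infix 4 _≟E_
  _≟E_ : DecidableEquality (Edge G)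
  edge x y _ _ ≟E edge x′ y′ _ _ with x ≟F x′ | y ≟F y′
  ... | yes refl | yes refl = yes refl
  ... | no x≢x′  | _        = no (x≢x′ ∘ cong end₁)
  ... | yes _    | no y≢y′  = no (y≢y′ ∘ cong end₂)

lineGraph : ∀ {n} (G : SimpleGraph (Fin n)) → SimpleGraph (Edge G)
lineGraph G = record
  { _~_      = λ e f → e ≢ f × ShareEnd e f
  ; _~?_     = λ e f → ¬? (e ≟E f) ×-dec any? λ x → isEnd? x e ×-dec isEnd? x f
  ; ~-sym    = λ { (e≢f , x , x∈e , x∈f) → e≢f ∘ sym , x , x∈f , x∈e }
  ; ~-irrefl = λ { (e≢e , _) → e≢e refl }
  }
  where
  isEnd? : Decidable (IsEnd {G = G})
  isEnd? x e = (x ≟F Edge.end₁ e) ⊎-dec (x ≟F Edge.end₂ e)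

-- An (s₁ , … , sₖ)-packing edge-coloring: distinct edges of the i-th class are
-- at distance at least sᵢ + 1 in the line graph.  Thus sᵢ = 1 gives a matching
-- and sᵢ = 2 an induced matching.
record PackingEdgeColoring {n k} (G : SimpleGraph (Fin n)) (s : Vec ℕ k) : Set where
  field
    class   : Edge G → Fin k
    packing : ∀ e f → e ≢ f → class e ≡ class f →
              DistanceAtLeast (lineGraph G) (suc (lookup s (class e))) e f

-- Planarity: the graph can be drawn with its edges as polygonal arcs that
-- meet only at common ends.  Corners are taken in ℚ²: the corners of a polygonal
-- drawing in ℝ² can be perturbed to rational points, and segments with rational
-- ends that meet in ℝ² meet in a rational point, so nothing is lost by
-- considering only rational points.

Point : Set
Point = ℚ × ℚ

data _∈[_,_] : Point → Point → Point → Set where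
  at : ∀ {x₀ y₀ x₁ y₁} (t : ℚ) → 0ℚ ℚ.≤ t → t ℚ.≤ 1ℚ →
       ((1ℚ ℚ.- t) ℚ.* x₀ ℚ.+ t ℚ.* x₁ , (1ℚ ℚ.- t) ℚ.* y₀ ℚ.+ t ℚ.* y₁)
       ∈[ (x₀ , y₀) , (x₁ , y₁) ]

-- A polygonal line is given by its first corner and the list of the others.
OnLine : Point → Point → List Point → Set
OnLine z p []       = z ≡ p
OnLine z p (q ∷ qs) = z ∈[ p , q ] ⊎ OnLine z q qs

-- No self-intersection: each segment meets the rest of the line only at the
-- corner where that rest begins.
IsArc : Point → List Point → Set
IsArc p []       = ⊤
IsArc p (q ∷ qs) =
  p ≢ q × (∀ z → z ∈[ p , q ] → OnLine z q qs → z ≡ q) × IsArc q qs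

record PlaneDrawing {n} (G : SimpleGraph (Fin n)) : Set where
  open Edge
  field
    point : Fin n → Point
    bends : Edge G → List Point

  corners : Edge G → List Point
  corners e = bends e ∷ʳ point (end₂ e)

  OnEdge : Point → Edge G → Set
  OnEdge z e = OnLine z (point (end₁ e)) (corners e)

  field
    point-injective : ∀ {x y} → point x ≡ point y → x ≡ y
    arcs            : ∀ e → IsArc (point (end₁ e)) (corners e)
    vertex-on-edge  : ∀ x e → OnEdge (point x) e → IsEnd x e
    edges-meet      : ∀ e f → e ≢ f → ∀ z → OnEdge z e → OnEdge z f →
                      ∃[ x ] IsEnd x e × IsEnd x f × z ≡ point x

Planar : ∀ {n} → SimpleGraph (Fin n) → Set
Planar = PlaneDrawing

fromEdges : ∀ {n} (es : List (Fin n × Fin n)) → All (uncurry _≢_) es →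
            SimpleGraph (Fin n)
fromEdges {n} es loopless = record
  { _~_      = λ x y → (x , y) ∈ es ⊎ (y , x) ∈ es
  ; _~?_     = λ x y → ((x , y) ∈? es) ⊎-dec ((y , x) ∈? es)
  ; ~-sym    = Sum.swap
  ; ~-irrefl = λ where
      (inj₁ xx∈es) → All.lookup loopless xx∈es refl
      (inj₂ xx∈es) → All.lookup loopless xx∈es refl
  }
  where open DecMembership (≡-dec (_≟F_ {n}) (_≟F_ {n})) using (_∈?_)

u₁ u₂ u₃ u₄ u₅ v₁ v₂ v₃ v₄ v₅ v₆ v₇ v₈ v₉ v₁₀ : Fin 15
u₁ = # 0
u₂ = # 1
u₃ = # 2
u₄ = # 3
u₅ = # 4
v₁ = # 5
v₂ = # 6
v₃ = # 7
v₄ = # 8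
v₅ = # 9
v₆ = # 10
v₇ = # 11
v₈ = # 12
v₉ = # 13
v₁₀ = # 14

edges₂ : List (Fin 15 × Fin 15)
edges₂ =
  (u₁ , u₂) ∷ (u₂ , u₃) ∷ (u₃ , u₄) ∷ (u₄ , u₅) ∷ (u₅ , u₁) ∷
  (v₁ , v₂) ∷ (v₂ , v₃) ∷ (v₃ , v₄) ∷ (v₄ , v₅) ∷ (v₅ , v₆) ∷
  (v₆ , v₇) ∷ (v₇ , v₈) ∷ (v₈ , v₉) ∷ (v₉ , v₁₀) ∷ (v₁₀ , v₁) ∷
  (u₁ , v₁) ∷ (u₂ , v₃) ∷ (u₃ , v₅) ∷ (u₄ , v₇) ∷ (u₅ , v₉) ∷ (v₄ , v₈) ∷ []

G₂ : SimpleGraph (Fin 15)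
G₂ = fromEdges edges₂ (from-yes (all? (λ (x , y) → ¬? (x ≟F y)) edges₂))

{-# OPTIONS --safe #-}
module Submission where

-- G₂ has a straight-line drawing with small integer coordinates.  That two of its
-- edges meet only at a common end is witnessed by the line through one of them,
-- which has the other on one side, so finitely many orientation signs establish
-- planarity.  For the coloring, a depth-first search assigns the edges to classes one
-- at a time; up to the names of the four induced matchings the search tree has only a
-- few hundred nodes, and each of its branches ends in two edges too close together.

open import Defs
open import Data.Empty using (⊥)
open import Data.Fin using (Fin; zero; suc)
import Data.Fin as Fin
import Data.Fin.Properties as Fin
open import Data.Integer.Base using (ℤ; +_; -_)
open import Data.List.Base using (List; []; _∷_)
open import Data.List.Membership.Propositional using (_∈_; find)
open import Data.List.Relation.Unary.All as All using (All; []; _∷_)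
open import Data.List.Relation.Unary.AllPairs using (_∷_)
open import Data.List.Relation.Unary.Any as Any using (Any; here; there)
open import Data.List.Relation.Unary.Linked using ([-]; _∷_; linked?)
open import Data.Nat.Base using (ℕ; zero; suc; _≤_; _<_; z≤n; s≤s)
import Data.Nat.Properties as ℕ
open import Data.Product.Base using (∃-syntax; _×_; _,_)
import Data.Product.Properties as Product
open import Data.Rational as ℚ using (ℚ; 0ℚ; 1ℚ)
import Data.Rational.Properties as ℚ
open import Data.Rational.Solver using (module +-*-Solver)
open import Data.Sum.Base using (_⊎_; inj₁; inj₂; [_,_])
open import Data.Unit.Base using (tt)
open import Data.Vec.Base as Vec using (Vec; []; _∷_)
import Data.Vec.Properties as Vec
open import Function.Base using (_∘_)
open import Relation.Binary.Definitions using (Decidable; tri<; tri≈; tri>)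
open import Relation.Binary.PropositionalEquality
  using (_≡_; _≢_; refl; sym; trans; cong; cong₂; subst)
open import Relation.Nullary
  using (¬_; Dec; yes; no; ¬?; contradiction; recompute; _×-dec_; _⊎-dec_; _→-dec_)
open import Relation.Nullary.Decidable using (True; toWitness; from-yes; map′)

-- Segments in the rational plane

mix : ℚ → ℚ → ℚ → ℚ
mix t a b = (1ℚ ℚ.- t) ℚ.* a ℚ.+ t ℚ.* b

mix-idem : ∀ t a → mix t a a ≡ a
mix-idem = solve 2 (λ t a → (con 1ℚ :- t) :* a :+ t :* a := a) refl
  where open +-*-Solver

mix-0 : ∀ a b → mix 0ℚ a b ≡ a
mix-0 = solve 2 (λ a b → (con 1ℚ :- con 0ℚ) :* a :+ con 0ℚ :* b := a) refl
  where open +-*-Solver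

mix-1 : ∀ a b → mix 1ℚ a b ≡ b
mix-1 = solve 2 (λ a b → (con 1ℚ :- con 1ℚ) :* a :+ con 1ℚ :* b := b) refl
  where open +-*-Solver

mix-swap : ∀ t a b → mix (1ℚ ℚ.- t) b a ≡ mix t a b
mix-swap = solve 3 (λ t a b → (con 1ℚ :- (con 1ℚ :- t)) :* b :+ (con 1ℚ :- t) :* a
                           := (con 1ℚ :- t) :* a :+ t :* b) refl
  where open +-*-Solver

0≤q-p : ∀ {p q} → p ℚ.≤ q → 0ℚ ℚ.≤ q ℚ.- p
0≤q-p {p} {q} p≤q = subst (ℚ._≤ q ℚ.- p) (ℚ.+-inverseʳ p) (ℚ.+-monoˡ-≤ (ℚ.- p) p≤q)

-- Both summands of `mix t a b` are nonnegative, and the second would be positive if `t` were.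
mix≡0⇒t≡0 : ∀ {t a b} → 0ℚ ℚ.≤ t → t ℚ.≤ 1ℚ → 0ℚ ℚ.≤ a → 0ℚ ℚ.< b →
            mix t a b ≡ 0ℚ → t ≡ 0ℚ
mix≡0⇒t≡0 {t} {a} {b} 0≤t t≤1 0≤a 0<b mix≡0 with 0ℚ ℚ.<? t
... | no  0≮t = ℚ.≤-antisym (ℚ.≮⇒≥ 0≮t) 0≤t
... | yes 0<t = contradiction (sym mix≡0) (ℚ.<⇒≢ 0<mix)
  where
  0≤s*a : 0ℚ ℚ.≤ (1ℚ ℚ.- t) ℚ.* a
  0≤s*a = ℚ.nonNegative⁻¹ _
    {{ℚ.nonNeg*nonNeg⇒nonNeg (1ℚ ℚ.- t) {{ℚ.nonNegative (0≤q-p t≤1)}} a {{ℚ.nonNegative 0≤a}}}}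
  0<t*b : 0ℚ ℚ.< t ℚ.* b
  0<t*b = ℚ.positive⁻¹ _
    {{ℚ.pos*pos⇒pos t {{ℚ.positive 0<t}} b {{ℚ.positive 0<b}}}}
  0<mix : 0ℚ ℚ.< mix t a b
  0<mix = ℚ.+-mono-≤-< 0≤s*a 0<t*b

segment-sym : ∀ {z p q} → z ∈[ p , q ] → z ∈[ q , p ]
segment-sym (at {x₀} {y₀} {x₁} {y₁} t 0≤t t≤1) =
  subst (_∈[ (x₁ , y₁) , (x₀ , y₀) ]) (cong₂ _,_ (mix-swap t x₀ x₁) (mix-swap t y₀ y₁))
    (at (1ℚ ℚ.- t) (0≤q-p t≤1) 1-t≤1)
  where
  1-t≤1 : 1ℚ ℚ.- t ℚ.≤ 1ℚ
  1-t≤1 = subst (1ℚ ℚ.- t ℚ.≤_) (ℚ.+-identityʳ 1ℚ)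
            (ℚ.+-monoʳ-≤ 1ℚ (ℚ.neg-antimono-≤ 0≤t))

end-∈ : ∀ p q → q ∈[ p , q ]
end-∈ p@(x₀ , y₀) q@(x₁ , y₁) =
  subst (_∈[ p , q ]) (cong₂ _,_ (mix-1 x₀ x₁) (mix-1 y₀ y₁))
    (at 1ℚ (from-yes (0ℚ ℚ.≤? 1ℚ)) ℚ.≤-refl)

-- Twice the signed area of the triangle p q z.
orient : Point → Point → Point → ℚ
orient (px , py) (qx , qy) (zx , zy) =
  (qx ℚ.- px) ℚ.* (zy ℚ.- py) ℚ.- (qy ℚ.- py) ℚ.* (zx ℚ.- px)

orient-start : ∀ p q → orient p q p ≡ 0ℚ
orient-start (px , py) (qx , qy) =
  solve 4 (λ px py qx qy → (qx :- px) :* (py :- py) :- (qy :- py) :* (px :- px) := con 0ℚ)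
    refl px py qx qy
  where open +-*-Solver

orient-end : ∀ p q → orient p q q ≡ 0ℚ
orient-end (px , py) (qx , qy) =
  solve 4 (λ px py qx qy → (qx :- px) :* (qy :- py) :- (qy :- py) :* (qx :- px) := con 0ℚ)
    refl px py qx qy
  where open +-*-Solver

orient-mix : ∀ p q {rx ry sx sy} t →
             orient p q (mix t rx sx , mix t ry sy) ≡
             mix t (orient p q (rx , ry)) (orient p q (sx , sy))
orient-mix (px , py) (qx , qy) {rx} {ry} {sx} {sy} t =
  -- The differences `qx - px` and `qy - py` enter as the single variables `a` and `b`, which keeps
  -- the polynomials small.
  solve 9 (λ a b px py rx ry sx sy t →
      a :* ((con 1ℚ :- t) :* ry :+ t :* sy :- py) :-
      b :* ((con 1ℚ :- t) :* rx :+ t :* sx :- px)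
    := (con 1ℚ :- t) :* (a :* (ry :- py) :- b :* (rx :- px)) :+
       t :* (a :* (sy :- py) :- b :* (sx :- px)))
    refl (qx ℚ.- px) (qy ℚ.- py) px py rx ry sx sy t
  where open +-*-Solver

orient-segment : ∀ {p q z} → z ∈[ p , q ] → orient p q z ≡ 0ℚ
orient-segment {p} {q} (at t _ _) = trans (orient-mix p q t)
  (trans (cong₂ (mix t) (orient-start p q) (orient-end p q)) (mix-idem t 0ℚ))

-- By `orient-mix`, orientation is affine along the segment from `r` to `s`. Being nonnegative at
-- `r` and positive at `s`, it can vanish only at parameter 0.
segment-meets-line : ∀ p q {r s z} → 0ℚ ℚ.≤ orient p q r → 0ℚ ℚ.< orient p q s →
                     z ∈[ r , s ] → orient p q z ≡ 0ℚ → z ≡ r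
segment-meets-line p q 0≤r 0<s (at {x₀} {y₀} {x₁} {y₁} t 0≤t t≤1) z≡0 =
  cong₂ _,_ (collapse x₀ x₁) (collapse y₀ y₁)
  where
  t≡0 : t ≡ 0ℚ
  t≡0 = mix≡0⇒t≡0 0≤t t≤1 0≤r 0<s (trans (sym (orient-mix p q t)) z≡0)
  collapse : ∀ a b → mix t a b ≡ a
  collapse a b = trans (cong (λ t′ → mix t′ a b) t≡0) (mix-0 a b)

-- Edges and their ends

module _ {n} {G : SimpleGraph (Fin n)} where
  open SimpleGraph G
  open Edge

  ends : Edge G → List (Fin n)
  ends e = end₁ e ∷ end₂ e ∷ []

  ∈ends⇒IsEnd : ∀ {x} (e : Edge G) → x ∈ ends e → IsEnd x e
  ∈ends⇒IsEnd e (here x≡)         = inj₁ x≡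
  ∈ends⇒IsEnd e (there (here x≡)) = inj₂ x≡

  end₁≢end₂ : (e : Edge G) → end₁ e ≢ end₂ e
  end₁≢end₂ (edge x y o _) = Fin.<⇒≢ (recompute (x Fin.<? y) o)

  edgeBetween : ∀ {x y} → x ~ y → ∃[ e ] IsEnd {G = G} x e × IsEnd y e
  edgeBetween {x} {y} x~y with Fin.<-cmp x y
  ... | tri< x<y _ _ = edge x y x<y x~y , inj₁ refl , inj₂ refl
  ... | tri≈ _ refl _ = contradiction x~y ~-irrefl
  ... | tri> _ _ y<x = edge y x y<x (~-sym x~y) , inj₂ refl , inj₁ refl

-- Straight-line drawings

module _ {n} {G : SimpleGraph (Fin n)} (point : Fin n → Point) where
  open Edge

  -- Reversing an edge flips the sign of `orient`, so in `Beside` the side of the line can always be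
  -- taken as the positive one. Reversing the other edge selects which of its ends may lie on the
  -- line.
  orientations : Edge G → List (Fin n × Fin n)
  orientations e = (end₁ e , end₂ e) ∷ (end₂ e , end₁ e) ∷ []

  -- f lies on one side of the line through e, except perhaps for a common end.
  Beside : Edge G → Edge G → Set
  Beside e f =
    Any (λ (p , q) → Any (λ (r , s) →
        0ℚ ℚ.< orient (point p) (point q) (point s) ×
        (r ∈ ends e ⊎ 0ℚ ℚ.< orient (point p) (point q) (point r)))
      (orientations f)) (orientations e)

  beside? : Decidable Beside
  beside? e f =
    Any.any? (λ (p , q) → Any.any? (λ (r , s) →
        (0ℚ ℚ.<? orient (point p) (point q) (point s)) ×-dec
        (Any.any? (r Fin.≟_) (ends e) ⊎-dec
         (0ℚ ℚ.<? orient (point p) (point q) (point r))))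
      (orientations f)) (orientations e)

  OnSegment : Point → Edge G → Set
  OnSegment z e = z ∈[ point (end₁ e) , point (end₂ e) ]

  onSegment-orientation : ∀ {z p q} e → (p , q) ∈ orientations e →
                          OnSegment z e → z ∈[ point p , point q ]
  onSegment-orientation e (here refl)         z∈e = z∈e
  onSegment-orientation e (there (here refl)) z∈e = segment-sym z∈e

  orientation-start : ∀ {r s} f → (r , s) ∈ orientations f → IsEnd r f
  orientation-start f (here refl)         = inj₁ refl
  orientation-start f (there (here refl)) = inj₂ refl

  orient-end-≡0 : ∀ {p q r} e → (p , q) ∈ orientations e → r ∈ ends e →
                  orient (point p) (point q) (point r) ≡ 0ℚ
  orient-end-≡0 e (here refl)         (here refl)         = orient-start (point _) (point _)
  orient-end-≡0 e (here refl)         (there (here refl)) = orient-end (point _) (point _)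
  orient-end-≡0 e (there (here refl)) (here refl)         = orient-end (point _) (point _)
  orient-end-≡0 e (there (here refl)) (there (here refl)) = orient-start (point _) (point _)

  -- A common point has orientation 0 with respect to `e`, so `segment-meets-line` makes it the
  -- start `r` of `f`. Either `r` is also an end of `e`, or its orientation is positive, which is
  -- absurd.
  beside⇒meet : ∀ e f {z} → Beside e f → OnSegment z e → OnSegment z f →
                ∃[ x ] IsEnd x e × IsEnd x f × z ≡ point x
  beside⇒meet e f {z} bes z∈e z∈f
    with (p , q) , pq∈ , bes′ ← find bes
    with (r , s) , rs∈ , 0<s , r-side ← find bes′ = meet r-side
    where
    z≡0 : orient (point p) (point q) z ≡ 0ℚ
    z≡0 = orient-segment (onSegment-orientation e pq∈ z∈e)
    z≡r : 0ℚ ℚ.≤ orient (point p) (point q) (point r) → z ≡ point r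
    z≡r 0≤r = segment-meets-line (point p) (point q) 0≤r 0<s
                (onSegment-orientation f rs∈ z∈f) z≡0
    meet : r ∈ ends e ⊎ 0ℚ ℚ.< orient (point p) (point q) (point r) →
           ∃[ x ] IsEnd x e × IsEnd x f × z ≡ point x
    meet (inj₁ r∈e) = r , ∈ends⇒IsEnd e r∈e , orientation-start f rs∈ ,
      z≡r (ℚ.≤-reflexive (sym (orient-end-≡0 e pq∈ r∈e)))
    meet (inj₂ 0<r) = contradiction
      (trans (sym z≡0) (cong (orient (point p) (point q)) (z≡r (ℚ.<⇒≤ 0<r))))
      (ℚ.<⇒≢ 0<r)

  straightLineDrawing :
    (∀ {x y} → point x ≡ point y → x ≡ y) →
    (∀ x → ∃[ e ] IsEnd {G = G} x e) →
    (∀ e f → e ≢ f → Beside e f ⊎ Beside f e) →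
    PlaneDrawing G
  straightLineDrawing injective covered beside = record
    { point           = point
    ; bends           = λ _ → []
    ; point-injective = injective
    -- Without bends, the rest of the line after its only segment is a single point.
    ; arcs            = λ e → end₁≢end₂ e ∘ injective , (λ _ _ z≡q → z≡q) , tt
    ; vertex-on-edge  = vertex-on-edge
    ; edges-meet      = λ e f e≢f z z∈e z∈f → meet e f e≢f (segment e z∈e) (segment f z∈f)
    }
    where
    segment : ∀ e {z} → OnLine z (point (end₁ e)) (point (end₂ e) ∷ []) → OnSegment z e
    segment e (inj₁ z∈e)  = z∈e
    segment e (inj₂ refl) = end-∈ _ _

    meet : ∀ e f → e ≢ f → ∀ {z} → OnSegment z e → OnSegment z f →
           ∃[ x ] IsEnd x e × IsEnd x f × z ≡ point x
    meet e f e≢f z∈e z∈f with beside e f e≢f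
    ... | inj₁ bes = beside⇒meet e f bes z∈e z∈f
    ... | inj₂ bes with x , x∈f , x∈e , z≡x ← beside⇒meet f e bes z∈f z∈e = x , x∈e , x∈f , z≡x

    end-onSegment : ∀ {x} e → IsEnd x e → OnSegment (point x) e
    end-onSegment e (inj₁ refl) = segment-sym (end-∈ _ _)
    end-onSegment e (inj₂ refl) = end-∈ _ _

    -- Some edge `f` ends at `x`. If `e` is a different edge through the point of `x`, then `e` and
    -- `f` meet there, hence at a common end, which is `x` by injectivity.
    vertex-on-edge : ∀ x e → OnLine (point x) (point (end₁ e)) (point (end₂ e) ∷ []) →
                     IsEnd x e
    vertex-on-edge x e x∈e with f , x∈f ← covered x | e ≟E f
    ... | yes refl = x∈f
    ... | no  e≢f
      with y , y∈e , _ , x≡y ← meet e f e≢f (segment e x∈e) (end-onSegment f x∈f)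
      = subst (λ v → IsEnd v e) (sym (injective x≡y)) y∈e

-- Packing colorings

module _ {n} {G : SimpleGraph (Fin n)}
         (neighbours : Fin n → List (Fin n))
         (neighbours-adjacent : ∀ x → All (SimpleGraph._~_ G x) (neighbours x)) where
  open SimpleGraph G

  -- A decidable condition forcing line-graph distance at most d (at most 2 if d > 2).
  Close : ℕ → Edge G → Edge G → Set
  Close zero          e f = ⊥
  Close (suc zero)    e f = Any (_∈ ends f) (ends e)
  Close (suc (suc _)) e f = Any (λ x → Any (_∈ ends f) (x ∷ neighbours x)) (ends e)

  close? : ∀ d → Decidable (Close d)
  close? zero          e f = no λ ()
  close? (suc zero)    e f = Any.any? (λ x → Any.any? (x Fin.≟_) (ends f)) (ends e)
  close? (suc (suc _)) e f =
    Any.any? (λ x → Any.any? (λ y → Any.any? (y Fin.≟_) (ends f)) (x ∷ neighbours x)) (ends e)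

  share⇒walk : ∀ (e f : Edge G) → e ≢ f → ShareEnd e f → Walk (lineGraph G) e f 1
  share⇒walk e f e≢f share = (e≢f , share) ∷ []

  -- The edge `g` joining `x` and `y` is the middle vertex of a walk of length 2. If `g` coincides
  -- with `e` or `f`, then `e` and `f` already share an end.
  adjacentEnds⇒walk : ∀ (e f : Edge G) {x y} → e ≢ f → IsEnd x e → IsEnd y f → x ~ y →
                      ∃[ l ] l ≤ 2 × Walk (lineGraph G) e f l
  adjacentEnds⇒walk e f {x} {y} e≢f x∈e y∈f x~y
    with g , x∈g , y∈g ← edgeBetween {G = G} x~y
    with e ≟E g | g ≟E f
  ... | yes refl | _        = 1 , s≤s z≤n , share⇒walk e f e≢f (y , y∈g , y∈f)
  ... | no  _    | yes refl = 1 , s≤s z≤n , share⇒walk e f e≢f (x , x∈e , x∈g)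
  ... | no  e≢g  | no  g≢f  = 2 , ℕ.≤-refl ,
    (e≢g , x , x∈e , x∈g) ∷ (g≢f , y , y∈g , y∈f) ∷ []

  close⇒walk : ∀ d e f → e ≢ f → Close d e f →
               ∃[ l ] l ≤ d × Walk (lineGraph G) e f l
  close⇒walk (suc zero) e f e≢f c with x , x∈e , x∈f ← find c =
    1 , ℕ.≤-refl , share⇒walk e f e≢f (x , ∈ends⇒IsEnd e x∈e , ∈ends⇒IsEnd f x∈f)
  close⇒walk (suc (suc d)) e f e≢f c with find c
  ... | x , x∈e , here x∈f =
    1 , s≤s z≤n , share⇒walk e f e≢f (x , ∈ends⇒IsEnd e x∈e , ∈ends⇒IsEnd f x∈f)
  ... | x , x∈e , there c′
    with y , y∈nx , y∈f ← find c′
    with l , l≤2 , w ← adjacentEnds⇒walk e f e≢f (∈ends⇒IsEnd e x∈e) (∈ends⇒IsEnd f y∈f)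
                         (All.lookup (neighbours-adjacent x) y∈nx)
    = l , ℕ.≤-trans l≤2 (s≤s (s≤s z≤n)) , w

  Clash : ℕ → Edge G → Edge G → Set
  Clash d e f = e ≢ f × Close d e f

  clash? : ∀ d → Decidable (Clash d)
  clash? d e f = ¬? (e ≟E f) ×-dec close? d e f

  -- A class with entry `d` demands distance at least `d + 1`, whereas a clash yields a walk of
  -- length at most `d`.
  ¬clash : ∀ {k} {s : Vec ℕ k} (χ : PackingEdgeColoring G s) →
           let open PackingEdgeColoring χ in
           ∀ e f → class e ≡ class f → ¬ Clash (Vec.lookup s (class e)) e f
  ¬clash χ e f same (e≢f , close) with l , l≤s , w ← close⇒walk _ e f e≢f close =
    ℕ.<⇒≱ (PackingEdgeColoring.packing χ e f e≢f same w) l≤s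

  -- Every way to extend a partial coloring, with first class M and further nonempty
  -- classes Cs (out of k), to the edges es leads to a clash.  The further classes are
  -- interchangeable, so at each step only one way to open a new one is considered.
  data Stuck (k : ℕ) {m} (M : List (Edge G)) (Cs : Vec (List (Edge G)) m) :
             List (Edge G) → Set where
    stuck : ∀ {e es} →
            Any (Clash 1 e) M ⊎ Stuck k (e ∷ M) Cs es →
            (∀ i → Any (Clash 2 e) (Vec.lookup Cs i) ⊎
                   Stuck k M (Vec.updateAt Cs i (e ∷_)) es) →
            (m < k → Stuck k M ((e ∷ []) ∷ Cs) es) →
            Stuck k M Cs (e ∷ es)

  stuck? : ∀ k {m} M (Cs : Vec (List (Edge G)) m) es → Dec (Stuck k M Cs es)
  stuck? k     M Cs []       = no λ ()
  stuck? k {m} M Cs (e ∷ es) =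
    map′ (λ (s₁ , s₂ , s₃) → stuck s₁ s₂ s₃) (λ { (stuck s₁ s₂ s₃) → s₁ , s₂ , s₃ })
      -- The clash is tested first, so the search descends only into placements without one.
      ((Any.any? (clash? 1 e) M ⊎-dec stuck? k (e ∷ M) Cs es) ×-dec
       (Fin.all? λ i → Any.any? (clash? 2 e) (Vec.lookup Cs i) ⊎-dec
                       stuck? k M (Vec.updateAt Cs i (e ∷_)) es) ×-dec
       ((m ℕ.<? k) →-dec stuck? k M ((e ∷ []) ∷ Cs) es))

  -- Soundness of the search

  module _ {k} (χ : PackingEdgeColoring G (1 ∷ Vec.replicate k 2)) where
    open PackingEdgeColoring χ

    -- The invariant of the descent: `χ` extends the partial coloring, once the anonymous open
    -- classes are identified through `name` with distinct classes of `χ`.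
    record Follows {m} (M : List (Edge G)) (Cs : Vec (List (Edge G)) m) : Set where
      field
        name           : Fin m → Fin k
        name-injective : ∀ {i j} → name i ≡ name j → i ≡ j
        first          : All (λ f → class f ≡ zero) M
        further        : ∀ i → All (λ f → class f ≡ suc (name i)) (Vec.lookup Cs i)

    -- The entry `d` comes with an equation because the lookup in `replicate` does not reduce at a
    -- variable index.
    ¬clash-in : ∀ {c e d fs} → class e ≡ c → Vec.lookup (1 ∷ Vec.replicate k 2) c ≡ d →
                All (λ f → class f ≡ c) fs → ¬ Any (Clash d e) fs
    ¬clash-in {e = e} refl refl fs∈c clash with f , f∈fs , cl ← find clash =
      ¬clash χ e f (sym (All.lookup fs∈c f∈fs)) cl

    module _ {m} {M} {Cs : Vec (List (Edge G)) m} (fol : Follows M Cs) where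
      open Follows fol

      follows-first : ∀ {e} → class e ≡ zero → Follows (e ∷ M) Cs
      follows-first e∈ = record
        { name = name ; name-injective = name-injective
        ; first = e∈ ∷ first ; further = further }

      follows-further : ∀ {e} i → class e ≡ suc (name i) →
                        Follows M (Vec.updateAt Cs i (e ∷_))
      follows-further {e} i e∈ = record
        { name = name ; name-injective = name-injective
        ; first = first ; further = further′ }
        where
        further′ : ∀ j → All (λ f → class f ≡ suc (name j))
                           (Vec.lookup (Vec.updateAt Cs i (e ∷_)) j)
        further′ j with j Fin.≟ i
        ... | yes refl = subst (All _) (sym (Vec.lookup∘updateAt i Cs)) (e∈ ∷ further i)
        ... | no  j≢i  = subst (All _) (sym (Vec.lookup∘updateAt′ j i j≢i Cs)) (further j)

      follows-new : ∀ {e c} → (∀ i → name i ≢ c) → class e ≡ suc c →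
                    Follows M ((e ∷ []) ∷ Cs)
      follows-new {e} {c} new e∈ = record
        { name = name′ ; name-injective = λ {i} {j} → injective i j
        ; first = first ; further = λ { zero → e∈ ∷ [] ; (suc i) → further i } }
        where
        name′ : Fin (suc m) → Fin k
        name′ zero    = c
        name′ (suc i) = name i
        injective : ∀ i j → name′ i ≡ name′ j → i ≡ j
        injective zero    zero    _  = refl
        injective zero    (suc j) eq = contradiction (sym eq) (new j)
        injective (suc i) zero    eq = contradiction eq (new i)
        injective (suc i) (suc j) eq = cong suc (name-injective eq)

    follows⇒≤ : ∀ {m M} {Cs : Vec (List (Edge G)) m} → Follows M Cs → m ≤ k
    follows⇒≤ fol = Fin.injective⇒≤ {f = name} name-injective
      where open Follows fol

    -- The class of each edge under `χ` singles out one branch of the refutation: the first class,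
    -- an open class, or a new one. Along this path no clash can occur, and at the empty list
    -- `Stuck` has no constructor.
    ¬stuck : ∀ {m M} {Cs : Vec (List (Edge G)) m} es → Follows M Cs → ¬ Stuck k M Cs es
    ¬stuck {M = M} {Cs} (e ∷ es) fol (stuck s₁ s₂ s₃) = by-class (class e) refl
      where
      open Follows fol
      by-class : ∀ c → class e ≢ c
      by-class zero e∈ =
        [ ¬clash-in e∈ refl first , ¬stuck es (follows-first fol e∈) ] s₁
      by-class (suc c) e∈ with Fin.any? (λ i → name i Fin.≟ c)
      ... | yes (i , refl) =
        [ ¬clash-in e∈ (Vec.lookup-replicate (name i) 2) (further i)
        , ¬stuck es (follows-further fol i e∈) ] (s₂ i)
      -- For the extended coloring, `follows⇒≤` reads `suc m ≤ k`, which is the required `m < k`.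
      ... | no  new = ¬stuck es fol′ (s₃ (follows⇒≤ fol′))
        where
        fol′ : Follows M ((e ∷ []) ∷ Cs)
        fol′ = follows-new fol (λ i eq → new (i , eq)) e∈

    ¬stuck-empty : ∀ es → ¬ Stuck k [] [] es
    ¬stuck-empty es = ¬stuck es record
      { name = λ () ; name-injective = λ { {()} } ; first = [] ; further = λ () }

-- Girth at least 5

module _ {V : Set} (G : SimpleGraph V) where
  open SimpleGraph G

  -- Cycles of length 3 and 4 are excluded by the two hypotheses. These interleave adjacencies with
  -- quantifiers so that deciding them explores only walks, not all tuples of vertices.
  girth≥5 : (∀ x y → x ~ y → ∀ z → y ~ z → ¬ z ~ x) →
            (∀ x y → x ~ y → ∀ z → y ~ z → x ≢ z → ∀ w → z ~ w → w ~ x → y ≡ w) →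
            ∀ C → 5 ≤ Cycle.length {G = G} C
  girth≥5 noTriangle noSquare C with C
  ... | record { rest = [] ; 3≤length = s≤s () }
  ... | record { rest = _ ∷ [] ; 3≤length = s≤s (s≤s ()) }
  ... | record { rest = _ ∷ _ ∷ [] ; closed = xy ∷ yz ∷ zx ∷ [-] } =
    contradiction zx (noTriangle _ _ xy _ yz)
  ... | record { rest = _ ∷ _ ∷ _ ∷ []
               ; closed = xy ∷ yz ∷ zw ∷ wx ∷ [-]
               ; distinct = (_ ∷ x≢z ∷ _) ∷ (_ ∷ y≢w ∷ _) ∷ _ } =
    contradiction (noSquare _ _ xy _ yz x≢z _ zw wx) y≢w
  ... | record { rest = _ ∷ _ ∷ _ ∷ _ ∷ _ } = s≤s (s≤s (s≤s (s≤s (s≤s z≤n))))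

-- The graph G₂

open SimpleGraph G₂ using (_~_; _~?_)

join : ∀ x y {x<y : True (x Fin.<? y)} {x~y : True (x ~? y)} → Edge G₂
join x y {x<y} {x~y} = edge x y (toWitness x<y) (toWitness x~y)

-- Listed so that most edges are close to many earlier ones, which keeps the search
-- tree of the colorings small.
allEdges : List (Edge G₂)
allEdges =
  join v₄ v₅ ∷ join v₄ v₈ ∷ join v₃ v₄ ∷ join v₇ v₈ ∷ join v₈ v₉ ∷ join v₅ v₆ ∷
  join v₆ v₇ ∷ join u₄ v₇ ∷ join u₃ v₅ ∷ join u₃ u₄ ∷ join u₂ u₃ ∷ join u₂ v₃ ∷
  join u₄ u₅ ∷ join u₅ v₉ ∷ join u₁ u₅ ∷ join u₁ u₂ ∷ join u₁ v₁ ∷ join v₁ v₁₀ ∷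
  join v₁ v₂ ∷ join v₉ v₁₀ ∷ join v₂ v₃ ∷ []

-- The proofs stored in an edge are irrelevant, so its two ends determine it and a check over all
-- pairs of vertices suffices.
∈allEdges : ∀ e → e ∈ allEdges
∈allEdges (edge x y o a) =
  Any.map (λ { (refl , refl) → refl })
    (listed x y (recompute (x Fin.<? y) o) (recompute (x ~? y) a))
  where
  listed : ∀ x y → x Fin.< y → x ~ y →
           Any (λ e → x ≡ Edge.end₁ e × y ≡ Edge.end₂ e) allEdges
  listed = from-yes (Fin.all? λ x → Fin.all? λ y → (x Fin.<? y) →-dec (x ~? y) →-dec
    Any.any? (λ e → (x Fin.≟ Edge.end₁ e) ×-dec (y Fin.≟ Edge.end₂ e)) allEdges)

subcubic : Subcubic G₂
subcubic = from-yes (maxDegree G₂ ℕ.≤? 3)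

-- The pentagon lies inside the ten-cycle, with the spokes between them, and the chord from `v₄` to
-- `v₈` passes outside on the left. The picture is symmetric about the horizontal axis.
position : Fin 15 → Point
position x = let i , j = Vec.lookup grid x in i ℚ./ 1 , j ℚ./ 1
  where
  grid : Vec (ℤ × ℤ) 15
  grid = (+ 2 , + 0) ∷ (+ 1 , + 2) ∷ (- + 2 , + 1) ∷ (- + 2 , - + 1) ∷ (+ 1 , - + 2) ∷
         (+ 3 , + 0) ∷ (+ 4 , + 3) ∷ (+ 2 , + 4) ∷ (- + 5 , + 8) ∷ (- + 3 , + 2) ∷
         (- + 4 , + 0) ∷ (- + 3 , - + 2) ∷ (- + 5 , - + 8) ∷ (+ 2 , - + 4) ∷ (+ 4 , - + 3) ∷ []

planar : Planar G₂
planar = straightLineDrawing position (λ {x} {y} → injective x y) covered beside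
  where
  injective : ∀ x y → position x ≡ position y → x ≡ y
  injective = from-yes (Fin.all? λ x → Fin.all? λ y →
    Product.≡-dec ℚ._≟_ ℚ._≟_ (position x) (position y) →-dec (x Fin.≟ y))

  onSomeEdge : ∀ x → Any (λ e → x ∈ ends e) allEdges
  onSomeEdge = from-yes (Fin.all? λ x →
    Any.any? (λ e → Any.any? (x Fin.≟_) (ends e)) allEdges)

  covered : ∀ x → ∃[ e ] IsEnd {G = G₂} x e
  covered x = let e , _ , x∈e = find (onSomeEdge x) in e , ∈ends⇒IsEnd e x∈e

  beside : ∀ e f → e ≢ f → Beside position e f ⊎ Beside position f e
  beside e f = All.lookup (All.lookup besides (∈allEdges e)) (∈allEdges f)
    where
    besides : All (λ e → All (λ f → e ≢ f → Beside position e f ⊎ Beside position f e)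
                allEdges) allEdges
    besides = from-yes (All.all? (λ e → All.all? (λ f →
      ¬? (e ≟E f) →-dec (beside? position e f ⊎-dec beside? position f e)) allEdges) allEdges)

pentagon : Cycle G₂
pentagon = record
  { start    = u₁
  ; rest     = u₂ ∷ u₃ ∷ u₄ ∷ u₅ ∷ []
  ; distinct = from-yes (unique? (u₁ ∷ u₂ ∷ u₃ ∷ u₄ ∷ u₅ ∷ []))
  ; closed   = from-yes (linked? _~?_ (u₁ ∷ u₂ ∷ u₃ ∷ u₄ ∷ u₅ ∷ u₁ ∷ []))
  ; 3≤length = s≤s (s≤s (s≤s z≤n))
  }
  where
  open import Data.List.Relation.Unary.Unique.DecPropositional Fin._≟_ using (unique?)

girth : HasGirth G₂ 5
girth = (pentagon , refl) , girth≥5 G₂ noTriangle noSquare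
  where
  noTriangle : ∀ x y → x ~ y → ∀ z → y ~ z → ¬ z ~ x
  noTriangle = from-yes (Fin.all? λ x → Fin.all? λ y → (x ~? y) →-dec
    Fin.all? λ z → (y ~? z) →-dec ¬? (z ~? x))

  noSquare : ∀ x y → x ~ y → ∀ z → y ~ z → x ≢ z → ∀ w → z ~ w → w ~ x → y ≡ w
  noSquare = from-yes (Fin.all? λ x → Fin.all? λ y → (x ~? y) →-dec
    Fin.all? λ z → (y ~? z) →-dec ¬? (x Fin.≟ z) →-dec
    Fin.all? λ w → (z ~? w) →-dec (w ~? x) →-dec (y Fin.≟ w))

-- A table, so that the search reads neighbours off directly instead of testing adjacency against
-- the edge list.
neighbours : Fin 15 → List (Fin 15)
neighbours = Vec.lookup
  ( (u₂ ∷ u₅ ∷ v₁ ∷ []) ∷ (u₁ ∷ u₃ ∷ v₃ ∷ []) ∷ (u₂ ∷ u₄ ∷ v₅ ∷ []) ∷ (u₃ ∷ u₅ ∷ v₇ ∷ [])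
  ∷ (u₁ ∷ u₄ ∷ v₉ ∷ [])
  ∷ (u₁ ∷ v₂ ∷ v₁₀ ∷ []) ∷ (v₁ ∷ v₃ ∷ []) ∷ (u₂ ∷ v₂ ∷ v₄ ∷ []) ∷ (v₃ ∷ v₅ ∷ v₈ ∷ [])
  ∷ (u₃ ∷ v₄ ∷ v₆ ∷ []) ∷ (v₅ ∷ v₇ ∷ []) ∷ (u₄ ∷ v₆ ∷ v₈ ∷ []) ∷ (v₄ ∷ v₇ ∷ v₉ ∷ [])
  ∷ (u₅ ∷ v₈ ∷ v₁₀ ∷ []) ∷ (v₁ ∷ v₉ ∷ []) ∷ [])

neighbours-adjacent : ∀ x → All (_~_ x) (neighbours x)
neighbours-adjacent = from-yes (Fin.all? λ x → All.all? (x ~?_) (neighbours x))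

allStuck : Stuck neighbours neighbours-adjacent 4 [] [] allEdges
allStuck = from-yes (stuck? neighbours neighbours-adjacent 4 [] [] allEdges)

uncolorable : ¬ PackingEdgeColoring G₂ (1 ∷ 2 ∷ 2 ∷ 2 ∷ 2 ∷ [])
-- At `k = 4` the vector `1 ∷ Vec.replicate k 2` computes to the one in the type of `χ`.
uncolorable χ = ¬stuck-empty {G = G₂} neighbours neighbours-adjacent {k = 4} χ allEdges allStuck

mainTheorem6 : Subcubic G₂ × Planar G₂ × HasGirth G₂ 5 × ¬ PackingEdgeColoring G₂ (1 ∷ 2 ∷ 2 ∷ 2 ∷ 2 ∷ [])
mainTheorem6 = subcubic , planar , girth , uncolorable
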